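{- As formal power series in $z$ (with coefficients polynomials in $x$ and $q$), \[ \sum_{0\leq k \leq n} S_1[n,k]\, x^k z^n = \cfrac{1}{ 1 - (x-[1]_q)z - \cfrac{[1]_q z}{ 1 - (x-[2]_q)z - \cfrac{[2]_qz}{ 1 - (x-[3]_q)z - \cfrac{[3]_qz}{\ddots} } } }. \]
   Context: $[i]_q=1+q+\dots+q^{i-1}$. For $n\geq 0$ let $\mathfrak{S}_n$ be the set of permutations of $\{1,\dots,n\}$. For $\sigma\in\mathfrak{S}_n$, a right-to-left maximum is an index $i$ such that $\sigma(i)>\sigma(j)$ for all $j$ with $i<j\leq n$; let $\mathrm{rlm}(\sigma)$ be their number. An inversion of $\sigma$ is a pair $(i,j)$ with $1\leq i<j\leq n$ and $\sigma(i)>\sigma(j)$; it is special if there exists $k'$ with $j<k'\leq n$ and $\sigma(i)<\sigma(k')$. Let $\mathrm{inv}'(\sigma)$ be the number of special inversions. For $0\leq k\leq n$, define $S_1[n,k]=\sum_{\sigma} q^{\mathrm{inv}'(\sigma)}$, summed over $\sigma\in\mathfrak{S}_n$ with $\mathrm{rlm}(\sigma)=k$ (so $S_1[0,0]=1$). -}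

module Defs where

open import Level using (Level)
open import Data.Bool using (Bool; true; false; if_then_else_; _∧_)
open import Data.Nat using (ℕ; zero; suc; _<ᵇ_; _≡ᵇ_)
open import Data.List using (List; []; _∷_; map; upTo; concatMap; filterᵇ; zipWith; foldr)
open import Data.Bool.ListAction using (all; any)
open import Algebra.Bundles using (CommutativeRing)

-- Permutations of {1,…,n}, represented as the word σ(1) σ(2) … σ(n).

vals : ℕ → List ℕ
vals n = map suc (upTo n)

words : ℕ → ℕ → List (List ℕ)
words n zero      = [] ∷ []
words n (suc len) = concatMap (λ w → map (λ a → a ∷ w) (vals n)) (words n len)

-- a word of length n over {1,…,n} is a permutation iff every i ∈ {1,…,n} occurs
isPerm : ℕ → List ℕ → Bool
isPerm n w = all (λ i → any (λ a → i ≡ᵇ a) w) (vals n)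

perms : ℕ → List (List ℕ)
perms n = filterᵇ (isPerm n) (words n n)

rlm : List ℕ → ℕ
rlm []       = zero
rlm (a ∷ as) = if all (λ b → b <ᵇ a) as then suc (rlm as) else rlm as

specialFrom : ℕ → List ℕ → ℕ
specialFrom a []       = zero
specialFrom a (b ∷ bs) =
  if (b <ᵇ a) ∧ any (λ c → a <ᵇ c) bs then suc (specialFrom a bs) else specialFrom a bs

inv' : List ℕ → ℕ
inv' []       = zero
inv' (a ∷ as) = specialFrom a as Data.Nat.+ inv' as

-- Everything below is evaluated in an arbitrary commutative ring R,
-- with x, q ∈ R (the polynomial identity in ℤ[x,q] is equivalent to the
-- identity holding for all commutative rings and all x, q).

module _ {c ℓ : Level} (R : CommutativeRing c ℓ) where
  open CommutativeRing R using (Carrier; _+_; _*_; -_; _-_; 0#; 1#)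

  sumR : List Carrier → Carrier
  sumR = foldr _+_ 0#

  infixr 8 _^ʳ_
  _^ʳ_ : Carrier → ℕ → Carrier
  a ^ʳ zero  = 1#
  a ^ʳ suc k = a * (a ^ʳ k)

  qint : Carrier → ℕ → Carrier
  qint q i = sumR (map (q ^ʳ_) (upTo i))

  S₁ : Carrier → ℕ → ℕ → Carrier
  S₁ q n k = sumR (map (λ σ → q ^ʳ inv' σ) (filterᵇ (λ σ → rlm σ ≡ᵇ k) (perms n)))

  lhsCoeff : Carrier → Carrier → ℕ → Carrier
  lhsCoeff x q n = sumR (map (λ k → S₁ q n k * (x ^ʳ k)) (upTo (suc n)))

  Series : Set c
  Series = ℕ → Carrier

  zeroS : Series
  zeroS _ = 0#

  -- multiplicative inverse of a series f with constant term 1: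
  -- g₀ = 1,  gₙ = - Σ_{k=1}^{n} f_k g_{n-k}  (n ≥ 1)
  module _ (f : Series) where
    -- prefix n = [g_{n-1}, …, g₁, g₀]
    nextCoeff : ℕ → List Carrier → Carrier
    prefix    : ℕ → List Carrier
    nextCoeff zero    gs = 1#
    nextCoeff (suc m) gs = - sumR (zipWith (λ k g → f k * g) (map suc (upTo (suc m))) gs)
    prefix zero    = []
    prefix (suc n) = nextCoeff n (prefix n) ∷ prefix n

    inv₁ : Series
    inv₁ n = nextCoeff n (prefix n)

  -- the series  1 - a z - b z F
  denom : Carrier → Carrier → Series → Series
  denom a b F zero          = 1#
  denom a b F (suc zero)    = - a - b * F zero
  denom a b F (suc (suc n)) = - (b * F (suc n))

  -- Truncated continued fraction: cfFrom x q d i is the level-i tail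
  --   1 / (1 - (x-[i+1]_q) z - [i+1]_q z / (1 - (x-[i+2]_q) z - … ))
  -- with d levels kept and the remaining tail replaced by 0.
  cfFrom : Carrier → Carrier → ℕ → ℕ → Series
  cfFrom x q zero    i = zeroS
  cfFrom x q (suc d) i =
    inv₁ (denom (x - qint q (suc i)) (qint q (suc i)) (cfFrom x q d (suc i)))

  convergent : Carrier → Carrier → ℕ → Series
  convergent x q m = cfFrom x q m zero

{-# OPTIONS --safe #-}
module Submission where

-- Read a permutation σ from right to left and keep only two numbers: how many entries remain to
-- be read, and the height h, the number of remaining entries smaller than the largest entry read.
-- If the next entry is not a right-to-left maximum, then h drops by one, and the rank of this entry
-- among the h candidates contributes a special inversion with each larger candidate, so the choices
-- sum to [h]_q.  If it is a right-to-left maximum (weight x), then h becomes any h' with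
-- h ≤ h' < number of remaining entries.  Hence the sum over permutations is a sum G_0 over weighted
-- lattice paths, where G_h (the paths starting at height h) satisfies
--   (1 - (x - [h+1]_q) z) G_h = [h]_q z G_{h-1} + G_{h+1}.
-- Dividing, G_h = [h]_q z F_h G_{h-1} with F_h the h-th tail of the continued fraction, and
-- G_0 = F_0.  As G_h = O(z^h), cutting off the fraction after m levels leaves the coefficients
-- below z^m unchanged.

open import Defs
open import Level using (Level)
open import Algebra.Bundles using (CommutativeRing)
import Algebra.Properties.CommutativeSemigroup as CommutativeSemigroupProperties
import Algebra.Properties.Ring as RingProperties
open import Data.Bool using (Bool; true; false; if_then_else_; not; _∧_; _∨_; T)
open import Data.Bool.ListAction using (all; any)
open import Data.Bool.Properties using (T-≡; T-∨)
open import Data.List using (List; []; _∷_; _++_; map; upTo; applyUpTo; zipWith; length; concatMap; filterᵇ)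
open import Data.List.Membership.Propositional using (_∈_; _∉_)
open import Data.List.Membership.Propositional.Properties using (∈-filter⁻; ∈-upTo⁻)
open import Data.List.Properties using (map-upTo; filter-all; upTo-∷ʳ; length-map; length-upTo)
open import Data.List.Relation.Unary.All as All using (All; []; _∷_)
import Data.List.Relation.Unary.All.Properties as All
open import Data.List.Relation.Unary.AllPairs using (AllPairs; []; _∷_)
import Data.List.Relation.Unary.AllPairs.Properties as AllPairs
open import Data.List.Relation.Unary.Any using (here; there)
open import Data.Nat using (ℕ; zero; suc; pred; _<_; _≤_; _<ᵇ_; _≡ᵇ_; z≤n; s≤s)
import Data.Nat as ℕ
open import Data.Nat.ListAction using (sum)
import Data.Nat.Properties as ℕ
open import Data.Nat.Solver using (module +-*-Solver)
open import Data.Product using (proj₂)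
open import Data.Sum using (inj₁; inj₂)
open import Function using (_∘_)
open import Function.Bundles using (Equivalence)
open import Relation.Binary.PropositionalEquality as ≡ using (_≡_; _≢_)
import Relation.Binary.Reasoning.Setoid as SetoidReasoning
open import Relation.Nullary using (¬_; yes; no; contradiction)
open import Relation.Nullary.Decidable using (T?)

-- Continued fractions

module Convolution {c ℓ : Level} (R : CommutativeRing c ℓ) where
  open CommutativeRing R hiding (zero)
  open SetoidReasoning setoid
  open RingProperties ring

  conv : Series R → Series R → Series R
  conv f g zero    = f 0 * g 0
  conv f g (suc n) = f 0 * g (suc n) + conv (f ∘ suc) g n

  conv-cong : ∀ {f f′ g g′ : Series R} n → (∀ i → i ≤ n → f i ≈ f′ i) →
              (∀ i → i ≤ n → g i ≈ g′ i) → conv f g n ≈ conv f′ g′ n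
  conv-cong zero    f≈ g≈ = *-cong (f≈ 0 z≤n) (g≈ 0 z≤n)
  conv-cong (suc n) f≈ g≈ =
    +-cong (*-cong (f≈ 0 z≤n) (g≈ (suc n) ℕ.≤-refl))
           (conv-cong n (λ i i≤n → f≈ (suc i) (s≤s i≤n)) (λ i i≤n → g≈ i (ℕ.m≤n⇒m≤1+n i≤n)))

  conv-sucʳ : ∀ f g n → conv f g (suc n) ≈ f (suc n) * g 0 + conv f (g ∘ suc) n
  conv-sucʳ f g zero    = +-comm _ _
  conv-sucʳ f g (suc n) = begin
    f 0 * g (2 ℕ.+ n) + conv (f ∘ suc) g (suc n)
      ≈⟨ +-congˡ (conv-sucʳ (f ∘ suc) g n) ⟩
    f 0 * g (2 ℕ.+ n) + (f (2 ℕ.+ n) * g 0 + conv (f ∘ suc) (g ∘ suc) n)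
      ≈⟨ x∙yz≈y∙xz _ _ _ ⟩
    f (2 ℕ.+ n) * g 0 + (f 0 * g (2 ℕ.+ n) + conv (f ∘ suc) (g ∘ suc) n) ∎
    where open CommutativeSemigroupProperties +-commutativeSemigroup using (x∙yz≈y∙xz)

  conv-comm : ∀ f g n → conv f g n ≈ conv g f n
  conv-comm f g zero    = *-comm _ _
  conv-comm f g (suc n) = begin
    f 0 * g (suc n) + conv (f ∘ suc) g n ≈⟨ +-cong (*-comm _ _) (conv-comm (f ∘ suc) g n) ⟩
    g (suc n) * f 0 + conv g (f ∘ suc) n ≈⟨ conv-sucʳ g f n ⟨
    conv g f (suc n) ∎

  -- The combination `a * f i + f′ i` has the shape of the shifted product `conv f g ∘ suc`, which
  -- is what the induction for `conv-assoc` meets.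
  conv-linearˡ : ∀ a f f′ g n →
                 conv (λ i → a * f i + f′ i) g n ≈ a * conv f g n + conv f′ g n
  conv-linearˡ a f f′ g zero    = trans (distribʳ _ _ _) (+-congʳ (*-assoc _ _ _))
  conv-linearˡ a f f′ g (suc n) = begin
    (a * f 0 + f′ 0) * g (suc n) + conv (λ i → a * f (suc i) + f′ (suc i)) g n
      ≈⟨ +-cong (distribʳ _ _ _) (conv-linearˡ a (f ∘ suc) (f′ ∘ suc) g n) ⟩
    (a * f 0 * g (suc n) + f′ 0 * g (suc n)) + (a * conv (f ∘ suc) g n + conv (f′ ∘ suc) g n)
      ≈⟨ interchange _ _ _ _ ⟩
    (a * f 0 * g (suc n) + a * conv (f ∘ suc) g n) + (f′ 0 * g (suc n) + conv (f′ ∘ suc) g n)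
      ≈⟨ +-congʳ (trans (+-congʳ (*-assoc _ _ _)) (sym (distribˡ _ _ _))) ⟩
    a * conv f g (suc n) + conv f′ g (suc n) ∎
    where open CommutativeSemigroupProperties +-commutativeSemigroup using (interchange)

  conv-assoc : ∀ f g h n → conv (conv f g) h n ≈ conv f (conv g h) n
  conv-assoc f g h zero    = *-assoc _ _ _
  conv-assoc f g h (suc n) = begin
    f 0 * g 0 * h (suc n) + conv (λ i → f 0 * g (suc i) + conv (f ∘ suc) g i) h n
      ≈⟨ +-cong (*-assoc _ _ _) (conv-linearˡ (f 0) (g ∘ suc) (conv (f ∘ suc) g) h n) ⟩
    f 0 * (g 0 * h (suc n)) + (f 0 * conv (g ∘ suc) h n + conv (conv (f ∘ suc) g) h n)
      ≈⟨ +-assoc _ _ _ ⟨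
    f 0 * (g 0 * h (suc n)) + f 0 * conv (g ∘ suc) h n + conv (conv (f ∘ suc) g) h n
      ≈⟨ +-cong (sym (distribˡ _ _ _)) (conv-assoc (f ∘ suc) g h n) ⟩
    conv f (conv g h) (suc n) ∎

  oneS : Series R
  oneS zero    = 1#
  oneS (suc _) = 0#

  conv-zeroˡ : ∀ g n → conv (zeroS R) g n ≈ 0#
  conv-zeroˡ g zero    = zeroˡ _
  conv-zeroˡ g (suc n) = trans (+-cong (zeroˡ _) (conv-zeroˡ g n)) (+-identityˡ _)

  conv-identityˡ : ∀ g n → conv oneS g n ≈ g n
  conv-identityˡ g zero    = *-identityˡ _
  conv-identityˡ g (suc n) = trans (+-cong (*-identityˡ _) (conv-zeroˡ g n)) (+-identityʳ _)

  -- `prefix` lists coefficients from the highest down, so zipping it with ascending indices gives a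
  -- Cauchy product. The index map `ρ` is arbitrary because each induction step replaces it by
  -- `ρ ∘ suc`.
  sum-zipWith-prefix : ∀ f ψ (ρ : ℕ → ℕ) m →
    sumR R (zipWith (λ k g → ψ k * g) (applyUpTo ρ (suc m)) (prefix R f (suc m)))
      ≈ conv (ψ ∘ ρ) (inv₁ R f) m
  sum-zipWith-prefix f ψ ρ zero    = +-identityʳ _
  sum-zipWith-prefix f ψ ρ (suc m) = +-congˡ (sum-zipWith-prefix f ψ (ρ ∘ suc) m)

  inv₁-suc : ∀ f m → inv₁ R f (suc m) ≈ - conv (f ∘ suc) (inv₁ R f) m
  inv₁-suc f m = -‿cong (trans
    (reflexive (≡.cong (λ ks → sumR R (zipWith (λ k g → f k * g) ks (prefix R f (suc m))))
                       (map-upTo suc (suc m))))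
    (sum-zipWith-prefix f f suc m))

  conv-inverseʳ : ∀ f → f 0 ≈ 1# → ∀ n → conv f (inv₁ R f) n ≈ oneS n
  conv-inverseʳ f f₀≈1 zero    = trans (*-identityʳ _) f₀≈1
  conv-inverseʳ f f₀≈1 (suc n) = begin
    f 0 * inv₁ R f (suc n) + conv (f ∘ suc) (inv₁ R f) n
      ≈⟨ +-congʳ (trans (*-congʳ f₀≈1) (trans (*-identityˡ _) (inv₁-suc f n))) ⟩
    - conv (f ∘ suc) (inv₁ R f) n + conv (f ∘ suc) (inv₁ R f) n
      ≈⟨ -‿inverseˡ _ ⟩
    0# ∎

  -- Only the coefficients of `B` up to `n` enter, so a product identity in low degrees suffices; a
  -- truncated fraction provides no more.
  conv-divide : ∀ f A B n → f 0 ≈ 1# → (∀ i → i ≤ n → conv f A i ≈ B i) →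
                A n ≈ conv (inv₁ R f) B n
  conv-divide f A B n f₀≈1 fA≈B = begin
    A n                            ≈⟨ conv-identityˡ A n ⟨
    conv oneS A n                  ≈⟨ conv-cong n (λ i _ → inverseˡ i) (λ _ _ → refl) ⟨
    conv (conv (inv₁ R f) f) A n   ≈⟨ conv-assoc (inv₁ R f) f A n ⟩
    conv (inv₁ R f) (conv f A) n   ≈⟨ conv-cong n (λ _ _ → refl) fA≈B ⟩
    conv (inv₁ R f) B n            ∎
    where
    inverseˡ : ∀ i → conv (inv₁ R f) f i ≈ oneS i
    inverseˡ i = trans (conv-comm (inv₁ R f) f i) (conv-inverseʳ f f₀≈1 i)

  conv-scaleˡ : ∀ a f g n → conv (λ i → a * f i) g n ≈ a * conv f g n
  conv-scaleˡ a f g n = begin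
    conv (λ i → a * f i) g n              ≈⟨ conv-cong n (λ _ _ → +-identityʳ _) (λ _ _ → refl) ⟨
    conv (λ i → a * f i + 0#) g n         ≈⟨ conv-linearˡ a f (zeroS R) g n ⟩
    a * conv f g n + conv (zeroS R) g n   ≈⟨ +-congˡ (conv-zeroˡ g n) ⟩
    a * conv f g n + 0#                   ≈⟨ +-identityʳ _ ⟩
    a * conv f g n                        ∎

  conv-scaleʳ : ∀ a f g n → conv f (λ i → a * g i) n ≈ a * conv f g n
  conv-scaleʳ a f g n = begin
    conv f (λ i → a * g i) n   ≈⟨ conv-comm f _ n ⟩
    conv (λ i → a * g i) f n   ≈⟨ conv-scaleˡ a g f n ⟩
    a * conv g f n             ≈⟨ *-congˡ (conv-comm g f n) ⟩
    a * conv f g n             ∎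

  conv-denom : ∀ a b F A n →
    conv (denom R a b F) A (suc n) ≈ A (suc n) + (- a * A n + - (b * conv F A n))
  conv-denom a b F A n = +-cong (*-identityˡ _) (begin
    conv (denom R a b F ∘ suc) A n
      ≈⟨ conv-cong n split (λ _ _ → refl) ⟩
    conv (λ i → - a * oneS i + - b * F i) A n
      ≈⟨ conv-linearˡ (- a) oneS (λ i → - b * F i) A n ⟩
    - a * conv oneS A n + conv (λ i → - b * F i) A n
      ≈⟨ +-cong (*-congˡ (conv-identityˡ A n)) (conv-scaleˡ (- b) F A n) ⟩
    - a * A n + - b * conv F A n
      ≈⟨ +-congˡ (-‿distribˡ-* _ _) ⟨
    - a * A n + - (b * conv F A n) ∎)
    where
    split : ∀ i → i ≤ n → denom R a b F (suc i) ≈ - a * oneS i + - b * F i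
    split zero    _ = +-cong (sym (*-identityʳ _)) (-‿distribˡ-* _ _)
    split (suc i) _ = begin
      - (b * F (suc i))              ≈⟨ -‿distribˡ-* _ _ ⟩
      - b * F (suc i)                ≈⟨ +-identityˡ _ ⟨
      0# + - b * F (suc i)           ≈⟨ +-congʳ (zeroʳ _) ⟨
      - a * 0# + - b * F (suc i)     ∎

-- Weighted lattice paths

module PathSum {c ℓ : Level} (R : CommutativeRing c ℓ)
               (x q : CommutativeRing.Carrier R) where
  open CommutativeRing R hiding (zero)
  open SetoidReasoning setoid
  open Convolution R
  open RingProperties ring

  [_] : ℕ → Carrier
  [ i ] = qint R q i

  -- Half-open: the terms g i with h ≤ i < L.
  sumBetween : (ℕ → Carrier) → ℕ → ℕ → Carrier
  sumBetween g h       zero    = 0#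
  sumBetween g zero    (suc L) = g 0 + sumBetween (g ∘ suc) zero L
  sumBetween g (suc h) (suc L) = sumBetween (g ∘ suc) h L

  -- The coefficient of `z^p` in `G_h`. The value of `pred 0` is harmless because `[ 0 ]` is zero,
  -- and the bound `suc p` counts the entries remaining before the step.
  paths : ℕ → ℕ → Carrier
  paths zero    zero    = 1#
  paths zero    (suc h) = 0#
  paths (suc p) h       = [ h ] * paths p (pred h) + x * sumBetween (paths p) h (suc p)

  -- For `h` at or beyond `L` both sums are empty, and the split survives because `g h` vanishes.
  -- This spares `paths-recurrence` a case distinction on the height.
  sumBetween-sucˡ : ∀ g h L → (∀ i → L ≤ i → g i ≈ 0#) →
                    sumBetween g h L ≈ g h + sumBetween g (suc h) L
  sumBetween-sucˡ g h       zero    g≈0 = trans (sym (g≈0 h z≤n)) (sym (+-identityʳ _))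
  sumBetween-sucˡ g zero    (suc L) g≈0 = refl
  sumBetween-sucˡ g (suc h) (suc L) g≈0 =
    sumBetween-sucˡ (g ∘ suc) h L (λ i L≤i → g≈0 (suc i) (s≤s L≤i))

  sumBetween-empty : ∀ g h L → L ≤ h → sumBetween g h L ≈ 0#
  sumBetween-empty g h       zero    _         = refl
  sumBetween-empty g (suc h) (suc L) (s≤s L≤h) = sumBetween-empty (g ∘ suc) h L L≤h

  paths-beyond : ∀ p h → p < h → paths p h ≈ 0#
  paths-beyond zero    (suc h) _         = refl
  paths-beyond (suc p) (suc h) (s≤s p<h) = begin
    [ suc h ] * paths p h + x * sumBetween (paths p) (suc h) (suc p)
      ≈⟨ +-cong (*-congˡ (paths-beyond p h p<h))
                (*-congˡ (sumBetween-empty (paths p) (suc h) (suc p) (s≤s (ℕ.<⇒≤ p<h)))) ⟩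
    [ suc h ] * 0# + x * 0#
      ≈⟨ +-cong (zeroʳ _) (zeroʳ _) ⟩
    0# + 0#
      ≈⟨ +-identityʳ _ ⟩
    0# ∎

  -- Record steps from `h` and from `suc h` reach the same heights except `h` itself. The long sums
  -- cancel in the difference, which leaves a relation between three neighbouring heights.
  paths-recurrence : ∀ n h →
    paths (suc n) h + (- (x - [ suc h ]) * paths n h + - paths (suc n) (suc h))
      ≈ [ h ] * paths n (pred h)
  paths-recurrence n h = begin
    ([ h ] * G₋ + x * sumBetween (paths n) h (suc n))
      + (- (x - [ suc h ]) * G₀ + - ([ suc h ] * G₀ + x * S))
      ≈⟨ +-congʳ (+-congˡ (*-congˡ (sumBetween-sucˡ (paths n) h (suc n) (paths-beyond n)))) ⟩
    ([ h ] * G₋ + x * (G₀ + S)) + (- (x - [ suc h ]) * G₀ + - ([ suc h ] * G₀ + x * S))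
      ≈⟨ +-congˡ (trans (+-congʳ (sym (-‿distribˡ-* _ _))) (trans (-‿+-comm _ _) (-‿cong regroup))) ⟩
    ([ h ] * G₋ + x * (G₀ + S)) + - (x * (G₀ + S))
      ≈⟨ trans (+-assoc _ _ _) (trans (+-congˡ (-‿inverseʳ _)) (+-identityʳ _)) ⟩
    [ h ] * G₋ ∎
    where
    G₋ = paths n (pred h)
    G₀ = paths n h
    S  = sumBetween (paths n) (suc h) (suc n)

    regroup : (x - [ suc h ]) * G₀ + ([ suc h ] * G₀ + x * S) ≈ x * (G₀ + S)
    regroup = begin
      (x - [ suc h ]) * G₀ + ([ suc h ] * G₀ + x * S)  ≈⟨ +-assoc _ _ _ ⟨
      (x - [ suc h ]) * G₀ + [ suc h ] * G₀ + x * S    ≈⟨ +-congʳ (distribʳ _ _ _) ⟨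
      (x - [ suc h ] + [ suc h ]) * G₀ + x * S
        ≈⟨ +-congʳ (*-congʳ (trans (+-assoc _ _ _) (trans (+-congˡ (-‿inverseˡ _)) (+-identityʳ _)))) ⟩
      x * G₀ + x * S                                   ≈⟨ distribˡ _ _ _ ⟨
      x * (G₀ + S)                                     ∎

  cfDenom : ℕ → ℕ → Series R
  cfDenom d h = denom R (x - [ suc h ]) [ suc h ] (cfFrom R x q d (suc h))

  -- The first passage below height suc h factors off the continued-fraction tail.
  first-passage : ∀ d h n → n < d ℕ.+ h →
    paths (suc n) (suc h) ≈ [ suc h ] * conv (cfFrom R x q d (suc h)) (λ i → paths i h) n
  -- A step lowers the height by at most one, so `suc n` steps from `suc h` cannot end at height 0:
  -- replacing the tail by zero costs nothing in this range.
  first-passage zero h n n<h = begin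
    paths (suc n) (suc h)                             ≈⟨ paths-beyond _ _ (s≤s n<h) ⟩
    0#                                                ≈⟨ zeroʳ _ ⟨
    [ suc h ] * 0#                                    ≈⟨ *-congˡ (conv-zeroˡ _ n) ⟨
    [ suc h ] * conv (zeroS R) (λ i → paths i h) n    ∎
  first-passage (suc d) h n (s≤s n≤d+h) = begin
    A n
      ≈⟨ conv-divide (cfDenom d (suc h)) A (λ i → [ suc h ] * paths i h) n refl
           (λ i i≤n → divided i (ℕ.≤-trans i≤n n≤d+h)) ⟩
    conv (cfFrom R x q (suc d) (suc h)) (λ i → [ suc h ] * paths i h) n
      ≈⟨ conv-scaleʳ _ _ _ n ⟩
    [ suc h ] * conv (cfFrom R x q (suc d) (suc h)) (λ i → paths i h) n ∎
    where
    -- `G_(h+1)` divided by `z`, which is possible because its constant term `paths 0 (suc h)` is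
    -- zero.
    A : Series R
    A n = paths (suc n) (suc h)
    F = cfFrom R x q d (2 ℕ.+ h)

    shifted : ∀ i → conv F (λ j → paths j (suc h)) (suc i) ≈ conv F A i
    shifted i = trans (conv-sucʳ F _ i) (trans (+-congʳ (zeroʳ _)) (+-identityˡ _))

    divided : ∀ i → i ≤ d ℕ.+ h → conv (cfDenom d (suc h)) A i ≈ [ suc h ] * paths i h
    divided zero    _     = begin
      1# * ([ suc h ] * paths 0 h + x * 0#)  ≈⟨ *-identityˡ _ ⟩
      [ suc h ] * paths 0 h + x * 0#         ≈⟨ +-congˡ (zeroʳ x) ⟩
      [ suc h ] * paths 0 h + 0#             ≈⟨ +-identityʳ _ ⟩
      [ suc h ] * paths 0 h                  ∎
    divided (suc i) i<d+h = begin
      conv (cfDenom d (suc h)) A (suc i)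
        ≈⟨ conv-denom _ _ F A i ⟩
      A (suc i) + (- (x - [ 2 ℕ.+ h ]) * A i + - ([ 2 ℕ.+ h ] * conv F A i))
        ≈⟨ +-congˡ (+-congˡ (-‿cong (*-congˡ (shifted i)))) ⟨
      A (suc i) + (- (x - [ 2 ℕ.+ h ]) * A i
        + - ([ 2 ℕ.+ h ] * conv F (λ j → paths j (suc h)) (suc i)))
        -- The next tail has one level fewer and starts one height higher, so the sum that bounds
        -- the degree stays the same.
        ≈⟨ +-congˡ (+-congˡ (-‿cong (first-passage d (suc h) (suc i)
             (≡.subst (suc i <_) (≡.sym (ℕ.+-suc d h)) (s≤s i<d+h))))) ⟨
      A (suc i) + (- (x - [ 2 ℕ.+ h ]) * A i + - paths (2 ℕ.+ i) (2 ℕ.+ h))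
        ≈⟨ paths-recurrence (suc i) (suc h) ⟩
      [ suc h ] * paths (suc i) h ∎

  -- At height 0 the down step has weight `[ 0 ]`, which is zero, so the recurrence closes: the top
  -- denominator times `G_0` is 1.
  convergent≈paths : ∀ n m → n < m → convergent R x q m n ≈ paths n 0
  convergent≈paths n (suc d) (s≤s n≤d) = sym (begin
    paths n 0
      ≈⟨ conv-divide (cfDenom d 0) (λ i → paths i 0) oneS n refl
           (λ i i≤n → divided i (ℕ.≤-trans i≤n n≤d)) ⟩
    conv (convergent R x q (suc d)) oneS n
      ≈⟨ conv-comm _ oneS n ⟩
    conv oneS (convergent R x q (suc d)) n
      ≈⟨ conv-identityˡ _ n ⟩
    convergent R x q (suc d) n ∎)
    where
    divided : ∀ i → i ≤ d → conv (cfDenom d 0) (λ j → paths j 0) i ≈ oneS i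
    divided zero    _   = *-identityˡ 1#
    divided (suc i) i<d = begin
      conv (cfDenom d 0) (λ j → paths j 0) (suc i)
        ≈⟨ conv-denom _ _ (cfFrom R x q d 1) (λ j → paths j 0) i ⟩
      paths (suc i) 0 + (- (x - [ 1 ]) * paths i 0
        + - ([ 1 ] * conv (cfFrom R x q d 1) (λ j → paths j 0) i))
        ≈⟨ +-congˡ (+-congˡ (-‿cong (first-passage d 0 i
             (≡.subst (i <_) (≡.sym (ℕ.+-identityʳ d)) i<d)))) ⟨
      paths (suc i) 0 + (- (x - [ 1 ]) * paths i 0 + - paths (suc i) 1)
        ≈⟨ paths-recurrence i 0 ⟩
      [ 0 ] * paths i 0
        ≈⟨ zeroˡ _ ⟩
      0# ∎

-- Right-to-left reading of permutations

T⇒true : ∀ {b} → T b → b ≡ true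
T⇒true = Equivalence.to T-≡

true⇒T : ∀ {b} → b ≡ true → T b
true⇒T = Equivalence.from T-≡

¬T⇒false : ∀ {b} → ¬ T b → b ≡ false
¬T⇒false {false} _  = ≡.refl
¬T⇒false {true}  ¬t = contradiction _ ¬t

false⇒¬T : ∀ {b} → b ≡ false → ¬ T b
false⇒¬T ≡.refl ()

<⇒<ᵇ≡true : ∀ {m n} → m < n → (m <ᵇ n) ≡ true
<⇒<ᵇ≡true m<n = T⇒true (ℕ.<⇒<ᵇ m<n)

≤⇒>ᵇ≡false : ∀ {m n} → m ≤ n → (n <ᵇ m) ≡ false
≤⇒>ᵇ≡false m≤n = ¬T⇒false (λ t → ℕ.≤⇒≯ m≤n (ℕ.<ᵇ⇒< _ _ t))

≢⇒≡ᵇ≡false : ∀ {m n} → m ≢ n → (m ≡ᵇ n) ≡ false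
≢⇒≡ᵇ≡false m≢n = ¬T⇒false (m≢n ∘ ℕ.≡ᵇ⇒≡ _ _)

≡ᵇ-refl : ∀ m → (m ≡ᵇ m) ≡ true
≡ᵇ-refl m = T⇒true (ℕ.≡⇒≡ᵇ m m ≡.refl)

<ᵇ-flip : ∀ m n → (m ≡ᵇ n) ≡ false → (n <ᵇ m) ≡ not (m <ᵇ n)
<ᵇ-flip zero    zero    ()
<ᵇ-flip zero    (suc n) _  = ≡.refl
<ᵇ-flip (suc m) zero    _  = ≡.refl
<ᵇ-flip (suc m) (suc n) eq = <ᵇ-flip m n eq

Increasing : List ℕ → Set
Increasing = AllPairs _<_

indicator : Bool → ℕ
indicator b = if b then 1 else 0

count : (ℕ → Bool) → List ℕ → ℕ
count P = sum ∘ map (indicator ∘ P)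

delete : ℕ → List ℕ → List ℕ
delete b = filterᵇ (λ c → not (c ≡ᵇ b))

sum-map-cong : ∀ {φ ψ : ℕ → ℕ} (C : List ℕ) → (∀ {c} → c ∈ C → φ c ≡ ψ c) →
               sum (map φ C) ≡ sum (map ψ C)
sum-map-cong []      φ≡ψ = ≡.refl
sum-map-cong (c ∷ C) φ≡ψ = ≡.cong₂ ℕ._+_ (φ≡ψ (here ≡.refl)) (sum-map-cong C (φ≡ψ ∘ there))

sum-map-0 : ∀ (C : List ℕ) → sum (map (λ _ → 0) C) ≡ 0
sum-map-0 []      = ≡.refl
sum-map-0 (_ ∷ C) = sum-map-0 C

sum-map-+ : ∀ (φ ψ : ℕ → ℕ) C →
            sum (map (λ c → φ c ℕ.+ ψ c) C) ≡ sum (map φ C) ℕ.+ sum (map ψ C)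
sum-map-+ φ ψ []      = ≡.refl
sum-map-+ φ ψ (c ∷ C) = ≡.trans (≡.cong (φ c ℕ.+ ψ c ℕ.+_) (sum-map-+ φ ψ C))
                                (interchange (φ c) _ _ _)
  where open CommutativeSemigroupProperties ℕ.+-commutativeSemigroup using (interchange)

count-none : ∀ {P : ℕ → Bool} C → (∀ {c} → c ∈ C → P c ≡ false) → count P C ≡ 0
count-none C ¬P = ≡.trans (sum-map-cong C (≡.cong indicator ∘ ¬P)) (sum-map-0 C)

count-cong : ∀ {P Q : ℕ → Bool} C → (∀ {c} → c ∈ C → P c ≡ Q c) → count P C ≡ count Q C
count-cong C P≡Q = sum-map-cong C (≡.cong indicator ∘ P≡Q)

delete-∉ : ∀ {b} C → b ∉ C → delete b C ≡ C
delete-∉ {b} C b∉C = filter-all (T? ∘ (λ c → not (c ≡ᵇ b))) (All.tabulate λ {c} c∈C →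
  true⇒T (≡.cong not (≢⇒≡ᵇ≡false {c} {b} (λ { ≡.refl → b∉C c∈C }))))

head∉tail : ∀ {c C} → All (c <_) C → c ∉ C
head∉tail c< c∈C = ℕ.<-irrefl ≡.refl (All.lookup c< c∈C)

sum-delete : ∀ (φ : ℕ → ℕ) {b C} → Increasing C → b ∈ C →
             sum (map φ C) ≡ φ b ℕ.+ sum (map φ (delete b C))
sum-delete φ {b} {C = .b ∷ C} (b< ∷ _)   (here ≡.refl)
  rewrite ≡ᵇ-refl b | delete-∉ C (head∉tail b<) = ≡.refl
sum-delete φ {b} {C = c ∷ C}  (c< ∷ inc) (there b∈C)
  rewrite ≢⇒≡ᵇ≡false (ℕ.<⇒≢ (All.lookup c< b∈C)) | sum-delete φ inc b∈C =
  x∙yz≈y∙xz (φ c) (φ b) _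
  where open CommutativeSemigroupProperties ℕ.+-commutativeSemigroup using (x∙yz≈y∙xz)

length≤suc-delete : ∀ b {C} → Increasing C → length C ≤ suc (length (delete b C))
length≤suc-delete b {[]}    _          = z≤n
length≤suc-delete b {c ∷ C} (c< ∷ inc) with c ≡ᵇ b in c≡b
... | false = s≤s (length≤suc-delete b inc)
... | true with ≡.refl ← ℕ.≡ᵇ⇒≡ c b (true⇒T c≡b) =
  s≤s (ℕ.≤-reflexive (≡.cong length (≡.sym (delete-∉ C (head∉tail c<)))))

length-delete : ∀ {b C} → Increasing C → b ∈ C → length C ≡ suc (length (delete b C))
length-delete {b} {C} inc b∈C = begin
  length C                             ≡⟨ length≡sum C ⟩
  sum (map (λ _ → 1) C)                ≡⟨ sum-delete (λ _ → 1) inc b∈C ⟩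
  suc (sum (map (λ _ → 1) (delete b C)))  ≡⟨ ≡.cong suc (length≡sum (delete b C)) ⟨
  suc (length (delete b C))            ∎
  where
  open ≡.≡-Reasoning
  length≡sum : ∀ (C : List ℕ) → length C ≡ sum (map (λ _ → 1) C)
  length≡sum []      = ≡.refl
  length≡sum (_ ∷ C) = ≡.cong suc (length≡sum C)

occurs : List ℕ → ℕ → Bool
occurs w i = any (λ a → i ≡ᵇ a) w

-- For a value `c` outside `w` this says that `c`, read next, is not a right-to-left maximum. It is
-- also literally the test for `k'` in `specialFrom`, so one predicate governs both statistics.
below : List ℕ → ℕ → Bool
below w c = any (λ d → c <ᵇ d) w

missing : ℕ → List ℕ → List ℕ
missing n w = filterᵇ (λ i → not (occurs w i)) (vals n)

vals-increasing : ∀ n → Increasing (vals n)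
vals-increasing n rewrite map-upTo suc n = AllPairs.applyUpTo⁺₁ suc n (λ i<j _ → s≤s i<j)

missing-increasing : ∀ n w → Increasing (missing n w)
missing-increasing n w = AllPairs.filter⁺ (T? ∘ (λ i → not (occurs w i))) (vals-increasing n)

missing-fresh : ∀ n w {b} → b ∈ missing n w → occurs w b ≡ false
missing-fresh n w {b} b∈ with occurs w b in eq | proj₂ (∈-filter⁻ (T? ∘ (λ i → not (occurs w i))) {xs = vals n} b∈)
... | false | _ = ≡.refl

filterᵇ-∨ : ∀ (P Q : ℕ → Bool) V →
            filterᵇ (λ i → not (P i ∨ Q i)) V ≡ filterᵇ (not ∘ P) (filterᵇ (not ∘ Q) V)
filterᵇ-∨ P Q []      = ≡.refl
filterᵇ-∨ P Q (v ∷ V) with Q v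
filterᵇ-∨ P Q (v ∷ V) | true  with P v
... | true  = filterᵇ-∨ P Q V
... | false = filterᵇ-∨ P Q V
filterᵇ-∨ P Q (v ∷ V) | false with P v
... | true  = filterᵇ-∨ P Q V
... | false = ≡.cong (v ∷_) (filterᵇ-∨ P Q V)

missing-∷ : ∀ n b w → missing n (b ∷ w) ≡ delete b (missing n w)
missing-∷ n b w = filterᵇ-∨ (_≡ᵇ b) (occurs w) (vals n)

missing-∷-occurs : ∀ n b w → occurs w b ≡ true → missing n (b ∷ w) ≡ missing n w
missing-∷-occurs n b w b∈w = ≡.trans (missing-∷ n b w) (delete-∉ (missing n w)
  (λ b∈ → contradiction (≡.trans (≡.sym b∈w) (missing-fresh n w b∈)) λ ()))

sum-missing : ∀ n w (φ : ℕ → ℕ) {b} → b ∈ missing n w →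
              sum (map φ (missing n w)) ≡ φ b ℕ.+ sum (map φ (missing n (b ∷ w)))
sum-missing n w φ {b} b∈ rewrite missing-∷ n b w = sum-delete φ (missing-increasing n w) b∈

length-missing : ∀ n w {b} → b ∈ missing n w →
                 length (missing n w) ≡ suc (length (missing n (b ∷ w)))
length-missing n w {b} b∈ rewrite missing-∷ n b w = length-delete (missing-increasing n w) b∈

isPerm-missing : ∀ n w → isPerm n w ≡ (length (missing n w) ≡ᵇ 0)
isPerm-missing n w = go (vals n)
  where
  go : ∀ V → all (occurs w) V ≡ (length (filterᵇ (λ i → not (occurs w i)) V) ≡ᵇ 0)
  go []      = ≡.refl
  go (v ∷ V) with occurs w v
  ... | true  = go V
  ... | false = ≡.refl

below-downward : ∀ w {b c} → c < b → T (below w b) → T (below w c)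
below-downward (d ∷ w) {b} {c} c<b t with Equivalence.to (T-∨ {b <ᵇ d}) t
... | inj₁ b<d = Equivalence.from (T-∨ {c <ᵇ d}) (inj₁ (ℕ.<⇒<ᵇ (ℕ.<-trans c<b (ℕ.<ᵇ⇒< b d b<d))))
... | inj₂ b<w = Equivalence.from (T-∨ {c <ᵇ d}) (inj₂ (below-downward w c<b b<w))

below-record : ∀ w {b c} → ¬ T (below w b) → T (below w c) → c < b
below-record (d ∷ w) {b} {c} b≮ c< with Equivalence.to (T-∨ {c <ᵇ d}) c<
... | inj₁ c<d = ℕ.<-≤-trans (ℕ.<ᵇ⇒< c d c<d)
                   (ℕ.≮⇒≥ (λ b<d → b≮ (Equivalence.from (T-∨ {b <ᵇ d}) (inj₁ (ℕ.<⇒<ᵇ b<d)))))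
... | inj₂ c<w = below-record w (λ b<w → b≮ (Equivalence.from (T-∨ {b <ᵇ d}) (inj₂ b<w))) c<w

below-∷-below : ∀ w {b} c → below w b ≡ true → below (b ∷ w) c ≡ below w c
below-∷-below w {b} c b<w with c <ᵇ b in c<b
... | false = ≡.refl
... | true  = ≡.sym (T⇒true (below-downward w (ℕ.<ᵇ⇒< c b (true⇒T c<b)) (true⇒T b<w)))

-- A record `b` is at least every entry of `w`, so it alone decides what lies below.
below-∷-record : ∀ w {b} c → below w b ≡ false → below (b ∷ w) c ≡ (c <ᵇ b)
below-∷-record w {b} c b≮w with c <ᵇ b in c<b
... | true  = ≡.refl
... | false = ¬T⇒false λ c<w →
  false⇒¬T c<b (ℕ.<⇒<ᵇ (below-record w (false⇒¬T b≮w) c<w))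

-- Freshness of `b` rules out ties, the only case in which "all smaller" and "none larger" differ.
all-<ᵇ : ∀ w b → occurs w b ≡ false → all (_<ᵇ b) w ≡ not (below w b)
all-<ᵇ []      b _   = ≡.refl
all-<ᵇ (d ∷ w) b b∉w with b ≡ᵇ d in b≢d
... | false rewrite <ᵇ-flip b d b≢d | all-<ᵇ w b b∉w with b <ᵇ d
...   | true  = ≡.refl
...   | false = ≡.refl

rlm-∷ : ∀ w b → occurs w b ≡ false → rlm (b ∷ w) ≡ indicator (not (below w b)) ℕ.+ rlm w
rlm-∷ w b b∉w rewrite all-<ᵇ w b b∉w with below w b
... | true  = ≡.refl
... | false = ≡.refl

specialFrom-∷ : ∀ c b w →
                specialFrom c (b ∷ w) ≡ indicator ((b <ᵇ c) ∧ below w c) ℕ.+ specialFrom c w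
specialFrom-∷ c b w with (b <ᵇ c) ∧ below w c
... | true  = ≡.refl
... | false = ≡.refl

-- The height of the path after w has been read.
active : ℕ → List ℕ → ℕ
active n w = count (below w) (missing n w)

-- The number of special inversions (i, j) with j in w, for any arrangement of the missing values
-- in front of w: whether such a pair is special depends only on σ(i) and w, since k' > j.
settled : ℕ → List ℕ → ℕ
settled n w = inv' w ℕ.+ sum (map (λ c → specialFrom c w) (missing n w))

-- The largest entry read is unchanged, and `b` was itself one of the values counted.
active-∷-below : ∀ n w {b} → b ∈ missing n w → below w b ≡ true →
                 active n (b ∷ w) ≡ pred (active n w)
active-∷-below n w {b} b∈ b<w rewrite sum-missing n w (indicator ∘ below w) b∈ | b<w =
  count-cong (missing n (b ∷ w)) (λ {c} _ → below-∷-below w c b<w)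

-- Since `b` is not smaller than itself, the count may run over `missing n w` with `b` included; the
-- new height is thus the rank of `b` among the candidates.
active-∷-record : ∀ n w {b} → b ∈ missing n w → below w b ≡ false →
                  active n (b ∷ w) ≡ count (_<ᵇ b) (missing n w)
active-∷-record n w {b} b∈ b≮w
  rewrite sum-missing n w (indicator ∘ (_<ᵇ b)) b∈ | ≤⇒>ᵇ≡false {b} ℕ.≤-refl =
  count-cong (missing n (b ∷ w)) (λ {c} _ → below-∷-record w c b≮w)

-- Pairs led by `b` were already counted while `b` was missing and merely move into `inv'`. The new
-- pairs have `b` second; one with a larger missing `c` in front is special exactly when `w` has an
-- entry above `c`.
settled-∷ : ∀ n w {b} → b ∈ missing n w →
  settled n (b ∷ w) ≡ count (λ c → (b <ᵇ c) ∧ below w c) (missing n w) ℕ.+ settled n w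
settled-∷ n w {b} b∈ = begin
  specialFrom b w ℕ.+ inv' w ℕ.+ sum (map (λ c → specialFrom c (b ∷ w)) C′)
    ≡⟨ ≡.cong (specialFrom b w ℕ.+ inv' w ℕ.+_)
         (≡.trans (sum-map-cong C′ (λ {c} _ → specialFrom-∷ c b w)) (sum-map-+ _ _ C′)) ⟩
  specialFrom b w ℕ.+ inv' w ℕ.+ (count P C′ ℕ.+ S)
    ≡⟨ rearrange (specialFrom b w) (inv' w) (count P C′) S ⟩
  count P C′ ℕ.+ (inv' w ℕ.+ (specialFrom b w ℕ.+ S))
    ≡⟨ ≡.cong₂ (λ k l → k ℕ.+ (inv' w ℕ.+ l)) count-C (sum-missing n w (λ c → specialFrom c w) b∈) ⟨
  count P (missing n w) ℕ.+ settled n w ∎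
  where
  open ≡.≡-Reasoning
  open +-*-Solver

  C′ = missing n (b ∷ w)
  S  = sum (map (λ c → specialFrom c w) C′)

  P : ℕ → Bool
  P c = (b <ᵇ c) ∧ below w c

  count-C : count P (missing n w) ≡ count P C′
  count-C rewrite sum-missing n w (indicator ∘ P) b∈ | ≤⇒>ᵇ≡false {b} ℕ.≤-refl = ≡.refl

  rearrange : ∀ a b c d → a ℕ.+ b ℕ.+ (c ℕ.+ d) ≡ c ℕ.+ (b ℕ.+ (a ℕ.+ d))
  rearrange = solve 4 (λ a b c d → a :+ b :+ (c :+ d) := c :+ (b :+ (a :+ d))) ≡.refl

rlm≤length : ∀ w → rlm w ≤ length w
rlm≤length []      = z≤n
rlm≤length (a ∷ w) with all (_<ᵇ a) w
... | true  = s≤s (rlm≤length w)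
... | false = ℕ.m≤n⇒m≤1+n (rlm≤length w)

words-length : ∀ n l → All (λ w → length w ≡ l) (words n l)
words-length n zero    = ≡.refl ∷ []
words-length n (suc l) = All.concat⁺ (All.map⁺ (All.map
  (λ eq → All.map⁺ (All.universal (λ _ → ≡.cong suc eq) (vals n))) (words-length n l)))

-- Sums over permutations

module ListSum {c ℓ : Level} (R : CommutativeRing c ℓ) where
  open CommutativeRing R hiding (zero)
  open SetoidReasoning setoid

  ∑ : {A : Set} → (A → Carrier) → List A → Carrier
  ∑ f l = sumR R (map f l)

  module _ {A : Set} where
    ∑-cong : ∀ {f g : A → Carrier} l → (∀ {a} → a ∈ l → f a ≈ g a) → ∑ f l ≈ ∑ g l
    ∑-cong []      f≈g = refl
    ∑-cong (a ∷ l) f≈g = +-cong (f≈g (here ≡.refl)) (∑-cong l (f≈g ∘ there))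

    ∑-zero : ∀ {f : A → Carrier} l → (∀ {a} → a ∈ l → f a ≈ 0#) → ∑ f l ≈ 0#
    ∑-zero []      f≈0 = refl
    ∑-zero (a ∷ l) f≈0 = trans (+-cong (f≈0 (here ≡.refl)) (∑-zero l (f≈0 ∘ there))) (+-identityˡ _)

    ∑-++ : ∀ (f : A → Carrier) l m → ∑ f (l ++ m) ≈ ∑ f l + ∑ f m
    ∑-++ f []      m = sym (+-identityˡ _)
    ∑-++ f (a ∷ l) m = trans (+-congˡ (∑-++ f l m)) (sym (+-assoc _ _ _))

    ∑-+ : ∀ (f g : A → Carrier) l → ∑ (λ a → f a + g a) l ≈ ∑ f l + ∑ g l
    ∑-+ f g []      = sym (+-identityˡ _)
    ∑-+ f g (a ∷ l) = trans (+-congˡ (∑-+ f g l)) (interchange _ _ _ _)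
      where open CommutativeSemigroupProperties +-commutativeSemigroup using (interchange)

    ∑-*ˡ : ∀ k (f : A → Carrier) l → ∑ (λ a → k * f a) l ≈ k * ∑ f l
    ∑-*ˡ k f []      = sym (zeroʳ _)
    ∑-*ˡ k f (a ∷ l) = trans (+-congˡ (∑-*ˡ k f l)) (sym (distribˡ _ _ _))

    ∑-filter : ∀ P (f : A → Carrier) l → (∀ {a} → a ∈ l → P a ≡ false → f a ≈ 0#) →
               ∑ f (filterᵇ P l) ≈ ∑ f l
    ∑-filter P f []      f≈0 = refl
    ∑-filter P f (a ∷ l) f≈0 with P a in Pa
    ... | true  = +-congˡ (∑-filter P f l (f≈0 ∘ there))
    ... | false = trans (∑-filter P f l (f≈0 ∘ there))
                        (sym (trans (+-congʳ (f≈0 (here ≡.refl) Pa)) (+-identityˡ _)))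

    ∑-filter-if : ∀ P (f : A → Carrier) l →
                  ∑ f (filterᵇ P l) ≈ ∑ (λ a → if P a then f a else 0#) l
    ∑-filter-if P f []      = refl
    ∑-filter-if P f (a ∷ l) with P a
    ... | true  = +-congˡ (∑-filter-if P f l)
    ... | false = trans (∑-filter-if P f l) (sym (+-identityˡ _))

  ∑-map : ∀ {A B : Set} (g : A → B) (f : B → Carrier) l → ∑ f (map g l) ≈ ∑ (f ∘ g) l
  ∑-map g f []      = refl
  ∑-map g f (a ∷ l) = +-congˡ (∑-map g f l)

  ∑-concatMap : ∀ {A B : Set} (g : A → List B) (f : B → Carrier) l →
                ∑ f (concatMap g l) ≈ ∑ (∑ f ∘ g) l
  ∑-concatMap g f []      = refl
  ∑-concatMap g f (a ∷ l) = trans (∑-++ f (g a) (concatMap g l)) (+-congˡ (∑-concatMap g f l))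

  ∑-upTo-suc : ∀ f n → ∑ f (upTo (suc n)) ≈ ∑ f (upTo n) + f n
  ∑-upTo-suc f n = begin
    ∑ f (upTo (suc n))             ≡⟨ ≡.cong (∑ f) (upTo-∷ʳ n) ⟨
    ∑ f (upTo n ++ n ∷ [])         ≈⟨ ∑-++ f (upTo n) (n ∷ []) ⟩
    ∑ f (upTo n) + (f n + 0#)      ≈⟨ +-congˡ (+-identityʳ _) ⟩
    ∑ f (upTo n) + f n             ∎

  ∑-upTo-single : ∀ r t (y : ℕ → Carrier) N → r < N →
                  ∑ (λ k → (if r ≡ᵇ k then t else 0#) * y k) (upTo N) ≈ t * y r
  ∑-upTo-single r t y (suc N) (s≤s r≤N) with r ℕ.≟ N
  ... | yes ≡.refl = begin
    ∑ f (upTo (suc r))     ≈⟨ ∑-upTo-suc f r ⟩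
    ∑ f (upTo r) + f r     ≈⟨ +-cong (∑-zero (upTo r) off) (reflexive on) ⟩
    0# + t * y r           ≈⟨ +-identityˡ _ ⟩
    t * y r                ∎
    where
    f : ℕ → Carrier
    f k = (if r ≡ᵇ k then t else 0#) * y k

    on : f r ≡ t * y r
    on rewrite ≡ᵇ-refl r = ≡.refl

    off : ∀ {k} → k ∈ upTo r → f k ≈ 0#
    off k∈ rewrite ≢⇒≡ᵇ≡false (ℕ.>⇒≢ (∈-upTo⁻ k∈)) = zeroˡ _
  ... | no r≢N = begin
    ∑ f (upTo (suc N))     ≈⟨ ∑-upTo-suc f N ⟩
    ∑ f (upTo N) + f N     ≈⟨ +-cong (∑-upTo-single r t y N (ℕ.≤∧≢⇒< r≤N r≢N)) off ⟩
    t * y r + 0#           ≈⟨ +-identityʳ _ ⟩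
    t * y r                ∎
    where
    f : ℕ → Carrier
    f k = (if r ≡ᵇ k then t else 0#) * y k

    off : f N ≈ 0#
    off rewrite ≢⇒≡ᵇ≡false r≢N = zeroˡ _

  -- Each `a` feeds the single index `k = s a`, and `s a < N` keeps it in range. With `s = rlm` this
  -- merges the `S₁` and the powers of `x` into one sum over permutations.
  ∑-fibres : ∀ {A : Set} (s : A → ℕ) (t : A → Carrier) (y : ℕ → Carrier) N l →
             All (λ a → s a < N) l →
             ∑ (λ k → ∑ t (filterᵇ (λ a → s a ≡ᵇ k) l) * y k) (upTo N) ≈ ∑ (λ a → t a * y (s a)) l
  ∑-fibres s t y N []      []         = ∑-zero (upTo N) (λ _ → zeroˡ _)
  ∑-fibres s t y N (a ∷ l) (a<N ∷ l<N) = begin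
    ∑ (λ k → ∑ t (filterᵇ (λ a → s a ≡ᵇ k) (a ∷ l)) * y k) (upTo N)
      ≈⟨ ∑-cong (upTo N) (λ {k} _ → trans (*-congʳ (head k)) (distribʳ _ _ _)) ⟩
    ∑ (λ k → (if s a ≡ᵇ k then t a else 0#) * y k
             + ∑ t (filterᵇ (λ a → s a ≡ᵇ k) l) * y k) (upTo N)
      ≈⟨ ∑-+ _ _ (upTo N) ⟩
    ∑ (λ k → (if s a ≡ᵇ k then t a else 0#) * y k) (upTo N)
      + ∑ (λ k → ∑ t (filterᵇ (λ a → s a ≡ᵇ k) l) * y k) (upTo N)
      ≈⟨ +-cong (∑-upTo-single (s a) (t a) y N a<N) (∑-fibres s t y N l l<N) ⟩
    t a * y (s a) + ∑ (λ a → t a * y (s a)) l ∎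
    where
    head : ∀ k → ∑ t (filterᵇ (λ a → s a ≡ᵇ k) (a ∷ l))
                 ≈ (if s a ≡ᵇ k then t a else 0#) + ∑ t (filterᵇ (λ a → s a ≡ᵇ k) l)
    head k with s a ≡ᵇ k
    ... | true  = refl
    ... | false = sym (+-identityˡ _)

module PermutationSum {c ℓ : Level} (R : CommutativeRing c ℓ)
                      (x q : CommutativeRing.Carrier R) where
  open CommutativeRing R hiding (zero)
  open SetoidReasoning setoid
  open ListSum R
  open PathSum R x q

  infixr 8 _^_
  _^_ : Carrier → ℕ → Carrier
  _^_ = _^ʳ_ R

  ^-+ : ∀ a m n → a ^ (m ℕ.+ n) ≈ a ^ m * a ^ n
  ^-+ a zero    n = sym (*-identityˡ _)
  ^-+ a (suc m) n = trans (*-congˡ (^-+ a m n)) (sym (*-assoc _ _ _))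

  -- The factor gained by reading `b` next when `C` lists the missing values: `β` stands for
  -- `below w`, `A` for the path sum after a drop, and `g` sends a new height to the path sum after
  -- a record.
  stepWeight : (ℕ → Bool) → Carrier → (ℕ → Carrier) → List ℕ → ℕ → Carrier
  stepWeight β A g C b =
    if β b then q ^ count (λ c → (b <ᵇ c) ∧ β c) C * A else x * g (count (_<ᵇ b) C)

  -- `C` is an initial segment of `h = count β C` values satisfying `β`, followed by records. Along
  -- the segment the exponents run from `h - 1` down to 0; the records have ranks `h` up to
  -- `length C - 1`.
  ∑-stepWeight : ∀ β A g C → Increasing C → (∀ {b c} → c < b → T (β b) → T (β c)) →
    ∑ (stepWeight β A g C) C ≈ [ count β C ] * A + x * sumBetween g (count β C) (length C)
  ∑-stepWeight β A g []      _          _    = sym (trans (+-cong (zeroˡ _) (zeroʳ _)) (+-identityʳ _))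
  ∑-stepWeight β A g (a ∷ C) (a< ∷ inc) down = split (β a) ≡.refl
    where
    h = count β C
    open CommutativeSemigroupProperties +-commutativeSemigroup using (x∙yz≈y∙xz)

    S : ℕ → Carrier
    S k = sumBetween (g ∘ suc) k (length C)

    -- Dropping the smallest value `a` leaves every exponent alone and lowers every rank by one,
    -- whence `g ∘ suc`.
    rest : ∑ (stepWeight β A g (a ∷ C)) C ≈ [ h ] * A + x * S h
    rest = trans (∑-cong C (reflexive ∘ shift)) (∑-stepWeight β A (g ∘ suc) C inc down)
      where
      shift : ∀ {b} → b ∈ C → stepWeight β A g (a ∷ C) b ≡ stepWeight β A (g ∘ suc) C b
      shift b∈C rewrite ≤⇒>ᵇ≡false (ℕ.<⇒≤ (All.lookup a< b∈C)) | <⇒<ᵇ≡true (All.lookup a< b∈C) = ≡.refl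

    rhs : ℕ → Carrier
    rhs k = [ k ] * A + x * sumBetween g k (suc (length C))

    split : ∀ v → β a ≡ v → ∑ (stepWeight β A g (a ∷ C)) (a ∷ C) ≈ rhs (indicator (β a) ℕ.+ h)
    -- All of `C` exceeds `a`, so the exponent for `a` is the full count `h`: the top power in
    -- `[ suc h ]`.
    split true βa = begin
      stepWeight β A g (a ∷ C) a + ∑ (stepWeight β A g (a ∷ C)) C
        ≈⟨ +-cong (reflexive first) rest ⟩
      q ^ h * A + ([ h ] * A + x * S h)
        ≈⟨ +-assoc _ _ _ ⟨
      q ^ h * A + [ h ] * A + x * S h
        ≈⟨ +-congʳ (distribʳ _ _ _) ⟨
      (q ^ h + [ h ]) * A + x * S h
        ≈⟨ +-congʳ (*-congʳ (trans (+-comm _ _) (sym (∑-upTo-suc (q ^_) h)))) ⟩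
      rhs (suc h)
        ≡⟨ ≡.cong (λ v → rhs (indicator v ℕ.+ h)) βa ⟨
      rhs (indicator (β a) ℕ.+ h) ∎
      where
      first : stepWeight β A g (a ∷ C) a ≡ q ^ h * A
      first rewrite βa | ≤⇒>ᵇ≡false {a} ℕ.≤-refl =
        ≡.cong (λ k → q ^ k * A)
          (count-cong C (λ {c} c∈C → ≡.cong (_∧ β c) (<⇒<ᵇ≡true (All.lookup a< c∈C))))
    -- If the smallest value is a record, so are all others, and the ranks start at 0.
    split false βa = begin
      stepWeight β A g (a ∷ C) a + ∑ (stepWeight β A g (a ∷ C)) C
        ≈⟨ +-cong (reflexive first) rest ⟩
      x * g 0 + ([ h ] * A + x * S h)
        ≡⟨ ≡.cong (λ k → x * g 0 + ([ k ] * A + x * S k)) none ⟩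
      x * g 0 + ([ 0 ] * A + x * S 0)
        ≈⟨ x∙yz≈y∙xz _ _ _ ⟩
      [ 0 ] * A + (x * g 0 + x * S 0)
        ≈⟨ +-congˡ (distribˡ _ _ _) ⟨
      rhs 0
        ≡⟨ ≡.cong rhs (≡.cong₂ ℕ._+_ (≡.cong indicator βa) none) ⟨
      rhs (indicator (β a) ℕ.+ h) ∎
      where
      none : h ≡ 0
      none = count-none C (λ b∈C → ¬T⇒false (λ βb → false⇒¬T βa (down (All.lookup a< b∈C) βb)))

      first : stepWeight β A g (a ∷ C) a ≡ x * g 0
      first rewrite βa | ≤⇒>ᵇ≡false {a} ℕ.≤-refl =
        ≡.cong (λ k → x * g k) (count-none C (λ c∈C → ≤⇒>ᵇ≡false (ℕ.<⇒≤ (All.lookup a< c∈C))))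

  module _ (n : ℕ) where

    ∑-prepend : ℕ → (List ℕ → Carrier) → List ℕ → Carrier
    ∑-prepend zero    f w = f w
    ∑-prepend (suc p) f w = ∑ (λ a → ∑-prepend p f (a ∷ w)) (vals n)

    -- `words` varies the leftmost letter innermost, while `∑-prepend` puts the letter next to `w`
    -- outermost, as reading from the right requires. This reconciles the two orders.
    ∑-prepend-suc : ∀ p f w →
      ∑-prepend p (λ v → ∑ (λ a → f (a ∷ v)) (vals n)) w ≈ ∑-prepend (suc p) f w
    ∑-prepend-suc zero    f w = refl
    ∑-prepend-suc (suc p) f w = ∑-cong (vals n) (λ {a} _ → ∑-prepend-suc p f (a ∷ w))

    ∑-words : ∀ p f → ∑ f (words n p) ≈ ∑-prepend p f []
    ∑-words zero    f = +-identityʳ _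
    ∑-words (suc p) f = begin
      ∑ f (words n (suc p))
        ≈⟨ ∑-concatMap _ f (words n p) ⟩
      ∑ (λ w → ∑ f (map (_∷ w) (vals n))) (words n p)
        ≈⟨ ∑-cong (words n p) (λ {w} _ → ∑-map (_∷ w) f (vals n)) ⟩
      ∑ (λ w → ∑ (λ a → f (a ∷ w)) (vals n)) (words n p)
        ≈⟨ ∑-words p _ ⟩
      ∑-prepend p (λ w → ∑ (λ a → f (a ∷ w)) (vals n)) []
        ≈⟨ ∑-prepend-suc p f [] ⟩
      ∑-prepend (suc p) f [] ∎

    weight : List ℕ → Carrier
    weight w = if isPerm n w then q ^ inv' w * x ^ rlm w else 0#

    -- Each letter supplies at most one missing value, so no completion by `p` letters is a
    -- permutation.
    ∑-prepend-vanishes : ∀ p w → p < length (missing n w) → ∑-prepend p weight w ≈ 0#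
    ∑-prepend-vanishes zero w 0<missing rewrite isPerm-missing n w with length (missing n w) | 0<missing
    ... | suc _ | _ = refl
    ∑-prepend-vanishes (suc p) w p<missing =
      ∑-zero (vals n) (λ {a} _ → ∑-prepend-vanishes p (a ∷ w) (ℕ.≤-pred (ℕ.≤-trans p<missing
        (≡.subst (λ C → length (missing n w) ≤ suc (length C)) (≡.sym (missing-∷ n a w))
          (length≤suc-delete a (missing-increasing n w))))))

    prefactor : List ℕ → Carrier
    prefactor w = q ^ settled n w * x ^ rlm w

    -- The invariant of the reading: what `w` has already determined factors out, and the rest
    -- depends only on `p` and the height. The induction chooses the next letter to the left.
    ∑-prepend-weight : ∀ p w → length (missing n w) ≡ p →
                       ∑-prepend p weight w ≈ prefactor w * paths p (active n w)
    ∑-prepend-weight zero w none rewrite isPerm-missing n w with missing n w | none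
    ... | [] | _ = sym (trans (*-identityʳ _)
                     (*-congʳ (reflexive (≡.cong (q ^_) (ℕ.+-identityʳ (inv' w))))))
    ∑-prepend-weight (suc p) w eq = begin
      ∑ (λ b → ∑-prepend p weight (b ∷ w)) (vals n)
        -- A repeated letter leaves `suc p` values missing with only `p` places to fill.
        ≈⟨ ∑-filter (λ i → not (occurs w i)) _ (vals n) (λ {b} _ → repeated b) ⟨
      ∑ (λ b → ∑-prepend p weight (b ∷ w)) (missing n w)
        ≈⟨ ∑-cong (missing n w) step ⟩
      ∑ (λ b → prefactor w * stepWeight (below w) A (paths p) (missing n w) b) (missing n w)
        ≈⟨ ∑-*ˡ _ _ (missing n w) ⟩
      prefactor w * ∑ (stepWeight (below w) A (paths p) (missing n w)) (missing n w)
        ≈⟨ *-congˡ (∑-stepWeight (below w) A (paths p) (missing n w)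
             (missing-increasing n w) (below-downward w)) ⟩
      prefactor w * ([ active n w ] * A + x * sumBetween (paths p) (active n w) (length (missing n w)))
        ≡⟨ ≡.cong (λ l → prefactor w * ([ active n w ] * A + x * sumBetween (paths p) (active n w) l)) eq ⟩
      prefactor w * paths (suc p) (active n w) ∎
      where
      A = paths p (pred (active n w))

      repeated : ∀ b → not (occurs w b) ≡ false → ∑-prepend p weight (b ∷ w) ≈ 0#
      repeated b b∈w with occurs w b in eq′
      ... | true = ∑-prepend-vanishes p (b ∷ w) (ℕ.≤-reflexive (≡.sym
                     (≡.trans (≡.cong length (missing-∷-occurs n b w eq′)) eq)))

      open CommutativeSemigroupProperties *-commutativeSemigroup

      step : ∀ {b} → b ∈ missing n w → ∑-prepend p weight (b ∷ w)
             ≈ prefactor w * stepWeight (below w) A (paths p) (missing n w) b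
      step {b} b∈ = trans (∑-prepend-weight p (b ∷ w)
                            (ℕ.suc-injective (≡.trans (≡.sym (length-missing n w b∈)) eq)))
                          (factor (below w b) ≡.refl)
        where
        e = count (λ c → (b <ᵇ c) ∧ below w c) (missing n w)

        -- A missing `c` above a record `b` cannot be below `w`, since `b` would then be too.
        no-inversion : below w b ≡ false → e ≡ 0
        no-inversion b≮w = count-none (missing n w) (λ {c} _ → ¬T⇒false (excluded c))
          where
          excluded : ∀ c → ¬ T ((b <ᵇ c) ∧ below w c)
          excluded c t with b <ᵇ c in b<c
          ... | true = false⇒¬T b≮w (below-downward w (ℕ.<ᵇ⇒< b c (true⇒T b<c)) t)

        factor : ∀ β → below w b ≡ β → prefactor (b ∷ w) * paths p (active n (b ∷ w))
                 ≈ prefactor w * stepWeight (below w) A (paths p) (missing n w) b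
        factor true b<w rewrite rlm-∷ w b (missing-fresh n w b∈) | active-∷-below n w b∈ b<w
                              | settled-∷ n w b∈ | b<w = begin
          q ^ (e ℕ.+ settled n w) * x ^ rlm w * A
            ≈⟨ *-congʳ (*-congʳ (trans (^-+ q e (settled n w)) (*-comm _ _))) ⟩
          q ^ settled n w * q ^ e * x ^ rlm w * A
            ≈⟨ *-congʳ (xy∙z≈xz∙y _ _ _) ⟩
          prefactor w * q ^ e * A
            ≈⟨ *-assoc _ _ _ ⟩
          prefactor w * (q ^ e * A) ∎
        factor false b≮w rewrite rlm-∷ w b (missing-fresh n w b∈) | active-∷-record n w b∈ b≮w
                               | settled-∷ n w b∈ | no-inversion b≮w | b≮w = begin
          q ^ settled n w * (x * x ^ rlm w) * g
            ≈⟨ *-congʳ (trans (*-congˡ (*-comm _ _)) (sym (*-assoc _ _ _))) ⟩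
          prefactor w * x * g
            ≈⟨ *-assoc _ _ _ ⟩
          prefactor w * (x * g) ∎
          where
          g = paths p (count (_<ᵇ b) (missing n w))

    lhsCoeff≈paths : lhsCoeff R x q n ≈ paths n 0
    lhsCoeff≈paths = begin
      lhsCoeff R x q n
        ≈⟨ ∑-fibres rlm (λ σ → q ^ inv' σ) (x ^_) (suc n) (perms n) rlm<suc-n ⟩
      ∑ (λ σ → q ^ inv' σ * x ^ rlm σ) (perms n)
        ≈⟨ ∑-filter-if (isPerm n) _ (words n n) ⟩
      ∑ weight (words n n)
        ≈⟨ ∑-words n weight ⟩
      ∑-prepend n weight []
        ≈⟨ ∑-prepend-weight n [] (≡.trans (≡.cong length missing-[]) (≡.trans (length-map suc (upTo n)) (length-upTo n))) ⟩
      q ^ settled n [] * 1# * paths n (active n [])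
        -- With nothing read, no value is below and no pair is settled, so the path starts at height
        -- 0 with weight 1.
        ≡⟨ ≡.cong₂ (λ e h → q ^ e * 1# * paths n h) (sum-map-0 (missing n [])) (sum-map-0 (missing n [])) ⟩
      1# * 1# * paths n 0
        ≈⟨ trans (*-congʳ (*-identityˡ 1#)) (*-identityˡ _) ⟩
      paths n 0 ∎
      where
      rlm<suc-n : All (λ σ → rlm σ < suc n) (perms n)
      rlm<suc-n = All.filter⁺ (T? ∘ isPerm n) (All.map
        (λ {σ} len → s≤s (ℕ.≤-trans (rlm≤length σ) (ℕ.≤-reflexive len))) (words-length n n))

      missing-[] : missing n [] ≡ vals n
      missing-[] = filter-all (λ _ → T? true) (All.universal _ (vals n))

theorem5p4 : ∀ {c ℓ : Level} (R : CommutativeRing c ℓ) (x q : CommutativeRing.Carrier R)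
    (n m : ℕ) → n < m →
    CommutativeRing._≈_ R (convergent R x q m n) (lhsCoeff R x q n)
theorem5p4 R x q n m n<m =
  trans (convergent≈paths n m n<m) (sym (lhsCoeff≈paths n))
  where
  open CommutativeRing R using (trans; sym)
  open PathSum R x q
  open PermutationSum R x q
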